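{- The variety $\mathsf{ImpBiLat}$ of implicative bilattices is generated by the four-element implicative bilattice $\mathcal{FOUR}_\supset$. As a consequence, $\mathbf{Alg}^{*}\mathcal{LB}_\supset=V(\mathcal{FOUR}_\supset)$.
   Context: A bilattice is an algebra $\langle B,\land,\lor,\otimes,\oplus,\neg\rangle$ such that $\langle B,\land,\lor\rangle$ and $\langle B,\otimes,\oplus\rangle$ are lattices (not necessarily bounded) with orders $\leq_t$ and $\leq_k$, and $\neg$ is unary with: $a\leq_t b\Rightarrow\neg b\leq_t\neg a$; $a\leq_k b\Rightarrow\neg a\leq_k\neg b$; $\neg\neg a=a$. An implicative bilattice is an algebra $\langle B,\land,\lor,\otimes,\oplus,\supset,\neg\rangle$ whose $\supset$-free reduct is a bilattice and which satisfies: (IB1) $(x\supset x)\supset y\approx y$; (IB2) $x\supset(y\supset z)\approx(x\land y)\supset z\approx(x\otimes y)\supset z$; (IB3) $((x\supset y)\supset x)\supset x\approx x\supset x$; (IB4) $(x\lor y)\supset z\approx(x\supset z)\land(y\supset z)\approx(x\oplus y)\supset z$; (IB5) $x\land((x\supset y)\supset(x\otimes y))\approx x$; (IB6) $\neg(x\supset y)\supset z\approx(x\land\neg y)\supset z$. $\mathcal{FOUR}_\supset$ has universe $\{\mathsf f,\bot,\top,\mathsf t\}$ with $\mathsf f<_t\bot,\top<_t\mathsf t$ ($\bot,\top$ $\leq_t$-incomparable), $\bot<_k\mathsf f,\mathsf t<_k\top$ ($\mathsf f,\mathsf t$ $\leq_k$-incomparable), $\neg\mathsf f=\mathsf t$,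 $\neg\mathsf t=\mathsf f$, $\neg\bot=\bot$, $\neg\top=\top$, and $a\supset b=b$ if $a\in\mathsf{Tr}=\{\top,\mathsf t\}$, $a\supset b=\mathsf t$ otherwise. $V(\cdot)$ denotes the generated variety. $\mathcal{LB}_\supset$ is the logic in the language $\{\land,\lor,\otimes,\oplus,\supset,\neg\}$ (formula algebra $\mathbf{Fm}$ over countably many variables) determined by the matrix $\langle\mathcal{FOUR}_\supset,\mathsf{Tr}\rangle$: $\Gamma\vdash\varphi$ iff for every homomorphism $h:\mathbf{Fm}\to\mathcal{FOUR}_\supset$, $h[\Gamma]\subseteq\mathsf{Tr}$ implies $h(\varphi)\in\mathsf{Tr}$. A matrix $\langle\mathbf A,F\rangle$ is a model of the logic if $\Gamma\vdash\varphi$ and $h[\Gamma]\subseteq F$ imply $h(\varphi)\in F$ for all homomorphisms $h:\mathbf{Fm}\to\mathbf A$; it is reduced if the greatest congruence of $\mathbf A$ compatible with $F$ (not relating elements of $F$ to elements outside $F$) is the identity. $\mathbf{Alg}^*\mathcal{LB}_\supset$ is the class of algebraic reducts of the reduced models of $\mathcal{LB}_\supset$. -}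

module Defs where

open import Algebra.Core using (Op₁; Op₂)
open import Algebra.Lattice.Structures using (IsLattice)
import Algebra.Definitions as Laws
open import Data.Nat.Base using (ℕ)
open import Data.Product.Base using (_×_; Σ-syntax)
open import Function.Definitions using (Congruent; Injective; Surjective)
open import Level using (Level; 0ℓ; suc; _⊔_)
open import Relation.Binary.Core using (Rel; _⇒_)
open import Relation.Binary.Definitions using (_Respects_)
open import Relation.Binary.Structures using (IsEquivalence)
open import Relation.Binary.PropositionalEquality.Core using (_≡_; cong; cong₂)
open import Relation.Binary.PropositionalEquality.Properties using () renaming (isEquivalence to ≡-isEquivalence)
open import Relation.Unary using (Pred)

private
  variable
    a b k ℓ x : Level

-- Algebras are setoid-based, so that quotients are available.  As with the
-- library's algebraic bundles, the carrier may be empty.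

record Algebra (ℓ : Level) : Set (suc ℓ) where
  infix  4 _≈_
  infix  8 ¬_
  infixl 7 _∧_ _⊗_
  infixl 6 _∨_ _⊕_
  infixr 5 _⊃_
  field
    Carrier       : Set ℓ
    _≈_           : Rel Carrier ℓ
    _∧_ _∨_       : Op₂ Carrier
    _⊗_ _⊕_       : Op₂ Carrier
    _⊃_           : Op₂ Carrier
    ¬_            : Op₁ Carrier
    ≈-equivalence : IsEquivalence _≈_
  open Laws _≈_ using (Congruent₁; Congruent₂)
  field
    ∧-cong : Congruent₂ _∧_
    ∨-cong : Congruent₂ _∨_
    ⊗-cong : Congruent₂ _⊗_
    ⊕-cong : Congruent₂ _⊕_
    ⊃-cong : Congruent₂ _⊃_
    ¬-cong : Congruent₁ ¬_

module _ (A : Algebra ℓ) where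
  open Algebra A

  infix 4 _≤ₜ_ _≤ₖ_

  _≤ₜ_ : Rel Carrier ℓ
  p ≤ₜ q = p ∧ q ≈ p

  _≤ₖ_ : Rel Carrier ℓ
  p ≤ₖ q = p ⊗ q ≈ p

  record IsBilattice : Set ℓ where
    field
      isLatticeₜ   : IsLattice _≈_ _∨_ _∧_
      isLatticeₖ   : IsLattice _≈_ _⊕_ _⊗_
      ¬-antitoneₜ  : ∀ p q → p ≤ₜ q → ¬ q ≤ₜ ¬ p
      ¬-monotoneₖ  : ∀ p q → p ≤ₖ q → ¬ p ≤ₖ ¬ q
      ¬-involutive : ∀ p → ¬ (¬ p) ≈ p

  record IsImplicativeBilattice : Set ℓ where
    field
      isBilattice : IsBilattice
      ib₁  : ∀ p q → ((p ⊃ p) ⊃ q) ≈ q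
      ib₂∧ : ∀ p q r → (p ⊃ (q ⊃ r)) ≈ ((p ∧ q) ⊃ r)
      ib₂⊗ : ∀ p q r → ((p ∧ q) ⊃ r) ≈ ((p ⊗ q) ⊃ r)
      ib₃  : ∀ p q → (((p ⊃ q) ⊃ p) ⊃ p) ≈ (p ⊃ p)
      ib₄∨ : ∀ p q r → ((p ∨ q) ⊃ r) ≈ ((p ⊃ r) ∧ (q ⊃ r))
      ib₄⊕ : ∀ p q r → ((p ⊃ r) ∧ (q ⊃ r)) ≈ ((p ⊕ q) ⊃ r)
      ib₅  : ∀ p q → (p ∧ ((p ⊃ q) ⊃ (p ⊗ q))) ≈ p
      ib₆  : ∀ p q r → (¬ (p ⊃ q) ⊃ r) ≈ ((p ∧ ¬ q) ⊃ r)

ImpBiLat : Pred (Algebra ℓ) ℓ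
ImpBiLat = IsImplicativeBilattice

module _ (A : Algebra a) (B : Algebra b) where
  private
    module A = Algebra A
    module B = Algebra B

  record IsHomomorphism (h : A.Carrier → B.Carrier) : Set (a ⊔ b) where
    field
      ≈-homo : Congruent A._≈_ B._≈_ h
      ∧-homo : ∀ p q → h (p A.∧ q) B.≈ (h p B.∧ h q)
      ∨-homo : ∀ p q → h (p A.∨ q) B.≈ (h p B.∨ h q)
      ⊗-homo : ∀ p q → h (p A.⊗ q) B.≈ (h p B.⊗ h q)
      ⊕-homo : ∀ p q → h (p A.⊕ q) B.≈ (h p B.⊕ h q)
      ⊃-homo : ∀ p q → h (p A.⊃ q) B.≈ (h p B.⊃ h q)
      ¬-homo : ∀ p → h (A.¬ p) B.≈ (B.¬ h p)

  record IsEmbedding (h : A.Carrier → B.Carrier) : Set (a ⊔ b) where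
    field
      isHomomorphism : IsHomomorphism h
      injective      : Injective A._≈_ B._≈_ h

  record IsEpimorphism (h : A.Carrier → B.Carrier) : Set (a ⊔ b) where
    field
      isHomomorphism : IsHomomorphism h
      surjective     : Surjective A._≈_ B._≈_ h

∏ : (I : Set ℓ) → (I → Algebra ℓ) → Algebra ℓ
∏ I A = record
  { Carrier = ∀ i → Carrier (A i)
  ; _≈_     = λ p q → ∀ i → _≈_ (A i) (p i) (q i)
  ; _∧_     = λ p q i → _∧_ (A i) (p i) (q i)
  ; _∨_     = λ p q i → _∨_ (A i) (p i) (q i)
  ; _⊗_     = λ p q i → _⊗_ (A i) (p i) (q i)
  ; _⊕_     = λ p q i → _⊕_ (A i) (p i) (q i)
  ; _⊃_     = λ p q i → _⊃_ (A i) (p i) (q i)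
  ; ¬_      = λ p i → ¬_ (A i) (p i)
  ; ≈-equivalence = record
    { refl  = λ i → IsEquivalence.refl (≈-equivalence (A i))
    ; sym   = λ p≈q i → IsEquivalence.sym (≈-equivalence (A i)) (p≈q i)
    ; trans = λ p≈q q≈r i → IsEquivalence.trans (≈-equivalence (A i)) (p≈q i) (q≈r i)
    }
  ; ∧-cong = λ p≈q r≈s i → ∧-cong (A i) (p≈q i) (r≈s i)
  ; ∨-cong = λ p≈q r≈s i → ∨-cong (A i) (p≈q i) (r≈s i)
  ; ⊗-cong = λ p≈q r≈s i → ⊗-cong (A i) (p≈q i) (r≈s i)
  ; ⊕-cong = λ p≈q r≈s i → ⊕-cong (A i) (p≈q i) (r≈s i)
  ; ⊃-cong = λ p≈q r≈s i → ⊃-cong (A i) (p≈q i) (r≈s i)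
  ; ¬-cong = λ p≈q i → ¬-cong (A i) (p≈q i)
  }
  where open Algebra

-- The least class containing K and closed under homomorphic images,
-- subalgebras (presented up to isomorphism, as embeddings) and products.

data V (K : Pred (Algebra ℓ) k) : Pred (Algebra ℓ) (suc ℓ ⊔ k) where
  generator  : ∀ {A} → K A → V K A
  image      : ∀ {A B} (h : Algebra.Carrier A → Algebra.Carrier B) →
               IsEpimorphism A B h → V K A → V K B
  subalgebra : ∀ {A B} (h : Algebra.Carrier A → Algebra.Carrier B) →
               IsEmbedding A B h → V K B → V K A
  product    : (I : Set ℓ) (A : I → Algebra ℓ) →
               (∀ i → V K (A i)) → V K (∏ I A)

-- A copy of the four-element set in every universe, so that FOUR belongs to
-- the algebras of each level.  The tables below are the meets and joins for
-- the orders 𝖿 <ₜ ⊥, ⊤ <ₜ 𝗍 and ⊥ <ₖ 𝖿, 𝗍 <ₖ ⊤.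

data Four {ℓ : Level} : Set ℓ where
  𝖿 ⊥ ⊤ 𝗍 : Four

module Four-operations {ℓ : Level} where

  _∧_ _∨_ _⊗_ _⊕_ _⊃_ : Op₂ (Four {ℓ})

  𝖿 ∧ q = 𝖿
  𝗍 ∧ q = q
  ⊥ ∧ 𝖿 = 𝖿
  ⊥ ∧ ⊥ = ⊥
  ⊥ ∧ ⊤ = 𝖿
  ⊥ ∧ 𝗍 = ⊥
  ⊤ ∧ 𝖿 = 𝖿
  ⊤ ∧ ⊥ = 𝖿
  ⊤ ∧ ⊤ = ⊤
  ⊤ ∧ 𝗍 = ⊤

  𝖿 ∨ q = q
  𝗍 ∨ q = 𝗍
  ⊥ ∨ 𝖿 = ⊥
  ⊥ ∨ ⊥ = ⊥
  ⊥ ∨ ⊤ = 𝗍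
  ⊥ ∨ 𝗍 = 𝗍
  ⊤ ∨ 𝖿 = ⊤
  ⊤ ∨ ⊥ = 𝗍
  ⊤ ∨ ⊤ = ⊤
  ⊤ ∨ 𝗍 = 𝗍

  ⊥ ⊗ q = ⊥
  ⊤ ⊗ q = q
  𝖿 ⊗ 𝖿 = 𝖿
  𝖿 ⊗ ⊥ = ⊥
  𝖿 ⊗ ⊤ = 𝖿
  𝖿 ⊗ 𝗍 = ⊥
  𝗍 ⊗ 𝖿 = ⊥
  𝗍 ⊗ ⊥ = ⊥
  𝗍 ⊗ ⊤ = 𝗍
  𝗍 ⊗ 𝗍 = 𝗍

  ⊥ ⊕ q = q
  ⊤ ⊕ q = ⊤
  𝖿 ⊕ 𝖿 = 𝖿
  𝖿 ⊕ ⊥ = 𝖿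
  𝖿 ⊕ ⊤ = ⊤
  𝖿 ⊕ 𝗍 = ⊤
  𝗍 ⊕ 𝖿 = ⊤
  𝗍 ⊕ ⊥ = 𝗍
  𝗍 ⊕ ⊤ = ⊤
  𝗍 ⊕ 𝗍 = 𝗍

  𝖿 ⊃ q = 𝗍
  ⊥ ⊃ q = 𝗍
  ⊤ ⊃ q = q
  𝗍 ⊃ q = q

  ¬_ : Op₁ (Four {ℓ})
  ¬ 𝖿 = 𝗍
  ¬ ⊥ = ⊥
  ¬ ⊤ = ⊤
  ¬ 𝗍 = 𝖿

FOUR : Algebra ℓ
FOUR = record
  { Carrier = Four
  ; _≈_ = _≡_
  ; _∧_ = _∧_ ; _∨_ = _∨_ ; _⊗_ = _⊗_ ; _⊕_ = _⊕_ ; _⊃_ = _⊃_ ; ¬_ = ¬_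
  ; ≈-equivalence = ≡-isEquivalence
  ; ∧-cong = cong₂ _∧_ ; ∨-cong = cong₂ _∨_
  ; ⊗-cong = cong₂ _⊗_ ; ⊕-cong = cong₂ _⊕_
  ; ⊃-cong = cong₂ _⊃_ ; ¬-cong = cong ¬_
  }
  where open Four-operations

data Tr : Pred (Four {0ℓ}) 0ℓ where
  ⊤∈Tr : Tr ⊤
  𝗍∈Tr : Tr 𝗍

data Term (X : Set x) : Set x where
  var                          : X → Term X
  _∧ᶠ_ _∨ᶠ_ _⊗ᶠ_ _⊕ᶠ_ _⊃ᶠ_ : Term X → Term X → Term X
  ¬ᶠ_                          : Term X → Term X

termAlgebra : Set x → Algebra x
termAlgebra X = record
  { Carrier = Term X
  ; _≈_ = _≡_
  ; _∧_ = _∧ᶠ_ ; _∨_ = _∨ᶠ_ ; _⊗_ = _⊗ᶠ_ ; _⊕_ = _⊕ᶠ_ ; _⊃_ = _⊃ᶠ_ ; ¬_ = ¬ᶠ_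
  ; ≈-equivalence = ≡-isEquivalence
  ; ∧-cong = cong₂ _∧ᶠ_ ; ∨-cong = cong₂ _∨ᶠ_
  ; ⊗-cong = cong₂ _⊗ᶠ_ ; ⊕-cong = cong₂ _⊕ᶠ_
  ; ⊃-cong = cong₂ _⊃ᶠ_ ; ¬-cong = cong ¬ᶠ_
  }

Formula : Set
Formula = Term ℕ

Fm : Algebra 0ℓ
Fm = termAlgebra ℕ

infix 3 _⊢_

_⊢_ : Pred Formula ℓ → Formula → Set ℓ
Γ ⊢ φ = ∀ (h : Formula → Four) → IsHomomorphism Fm FOUR h →
        (∀ γ → Γ γ → Tr (h γ)) → Tr (h φ)

module _ (A : Algebra ℓ) (F : Pred (Algebra.Carrier A) ℓ) where
  open Algebra A

  IsModel : Set (suc ℓ)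
  IsModel = ∀ (Γ : Pred Formula ℓ) (φ : Formula) → Γ ⊢ φ →
            ∀ (h : Formula → Carrier) → IsHomomorphism Fm A h →
            (∀ γ → Γ γ → F (h γ)) → F (h φ)

  record IsCompatibleCongruence (θ : Rel Carrier ℓ) : Set ℓ where
    field
      reflexive     : _≈_ ⇒ θ
      isEquivalence : IsEquivalence θ
      ∧-compatible  : Laws.Congruent₂ θ _∧_
      ∨-compatible  : Laws.Congruent₂ θ _∨_
      ⊗-compatible  : Laws.Congruent₂ θ _⊗_
      ⊕-compatible  : Laws.Congruent₂ θ _⊕_
      ⊃-compatible  : Laws.Congruent₂ θ _⊃_
      ¬-compatible  : Laws.Congruent₁ θ ¬_
      F-compatible  : F Respects θ

  record IsGreatestCompatibleCongruence (θ : Rel Carrier ℓ) : Set (suc ℓ) where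
    field
      isCompatibleCongruence : IsCompatibleCongruence θ
      greatest : ∀ ρ → IsCompatibleCongruence ρ → ρ ⇒ θ

  IsReduced : Set (suc ℓ)
  IsReduced = IsGreatestCompatibleCongruence _≈_

-- The respect condition says that F is a subset of the setoid A.

Alg*LB⊃ : Pred (Algebra ℓ) (suc ℓ)
Alg*LB⊃ A = Σ[ F ∈ Pred (Algebra.Carrier A) _ ]
  (F Respects Algebra._≈_ A) × IsModel A F × IsReduced A F

{-# OPTIONS --safe #-}
module Submission where

-- Call p designated when p ⊃ p ≈ p.  By IB5 a designated p ⊃ q gives p ≤ₜ p ⊗ q,
-- and hence p ≈ q as soon as p, q and ¬ p, ¬ q imply each other: the designated
-- elements form a reduced model.  An undesignated element c is kept out of a filter
-- that decides countably many given elements; since only countably many have to be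
-- decided, excluded middle suffices and no choice principle is used.  Membership of p
-- and ¬ p in the filter is a valuation in FOUR.  So the identities of FOUR hold in
-- every implicative bilattice, which is therefore a quotient of a free algebra of
-- V(FOUR), and the consequences of LB⊃, also from infinitely many premises, preserve
-- designation.  Conversely, in a reduced model mutual implication of p, q and of
-- ¬ p, ¬ q is a compatible congruence, hence the identity, so all identities of FOUR
-- hold; the axioms of implicative bilattices follow from these.

open import Defs
open import Algebra.Lattice.Bundles using (Lattice)
open import Algebra.Lattice.Structures using (IsLattice)
import Algebra.Lattice.Properties.Lattice as LatticeProperties
open import Axiom.ExcludedMiddle using (ExcludedMiddle)
open import Data.Bool as Bool using (Bool; true; false)
import Data.Empty as Empty
open import Data.List.Base using (List; []; _∷_; [_]; _++_; concatMap)
open import Data.List.Membership.Propositional using (_∈_)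
open import Data.List.Membership.Propositional.Properties using (∈-++⁺ˡ; ∈-++⁺ʳ)
open import Data.List.Relation.Unary.All as All using (All; []; _∷_)
open import Data.List.Relation.Unary.All.Properties using (concat⁺; concat⁻; map⁺; map⁻)
open import Data.List.Relation.Unary.Any using (here; there)
open import Data.Nat.Base using (ℕ; zero; suc; _⊔_; _≤′_; ≤′-refl; ≤′-step)
open import Data.Nat.Properties using (m≤m⊔n; m≤n⊔m; ≤⇒≤′)
open import Data.Product.Base using (_×_; _,_; proj₁; proj₂; ∃; uncurry)
open import Data.Sum.Base using (_⊎_; inj₁; inj₂)
open import Function.Base using (_∘_; id)
open import Level using (Level; 0ℓ; Lift; lift; lower)
open import Relation.Binary.Bundles using (Setoid)
open import Relation.Binary.Core using (Rel)
open import Relation.Binary.Definitions using (DecidableEquality; _Respects_)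
open import Relation.Binary.Lattice.Structures using (IsMeetSemilattice)
open import Relation.Binary.PropositionalEquality
  using (_≡_; refl; sym; trans; cong; cong₂; subst)
  renaming (isEquivalence to ≡-isEquivalence)
import Relation.Binary.Reasoning.Setoid as SetoidReasoning
open import Relation.Binary.Structures using (IsEquivalence)
open import Relation.Nullary.Decidable using (Dec; yes; no; does; from-yes; map′; _×-dec_; _→-dec_)
open import Relation.Nullary.Negation using (contradiction) renaming (¬_ to not_)
open import Relation.Unary using (_≐_; ｛_｝; Pred; Decidable)

private
  variable
    a b f k ℓ x : Level
    X : Set x

-- Term evaluation, homomorphisms and identities.

setoid : Algebra a → Setoid a a
setoid A = record { isEquivalence = Algebra.≈-equivalence A }

module _ (A : Algebra a) where
  open Algebra A

  eval : Term X → (X → Carrier) → Carrier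
  eval (var i)  v = v i
  eval (s ∧ᶠ t) v = eval s v ∧ eval t v
  eval (s ∨ᶠ t) v = eval s v ∨ eval t v
  eval (s ⊗ᶠ t) v = eval s v ⊗ eval t v
  eval (s ⊕ᶠ t) v = eval s v ⊕ eval t v
  eval (s ⊃ᶠ t) v = eval s v ⊃ eval t v
  eval (¬ᶠ s)   v = ¬ eval s v

  eval-cong : ∀ (t : Term X) {v w : X → Carrier} → (∀ i → v i ≈ w i) → eval t v ≈ eval t w
  eval-cong (var i)  v≈w = v≈w i
  eval-cong (s ∧ᶠ t) v≈w = ∧-cong (eval-cong s v≈w) (eval-cong t v≈w)
  eval-cong (s ∨ᶠ t) v≈w = ∨-cong (eval-cong s v≈w) (eval-cong t v≈w)
  eval-cong (s ⊗ᶠ t) v≈w = ⊗-cong (eval-cong s v≈w) (eval-cong t v≈w)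
  eval-cong (s ⊕ᶠ t) v≈w = ⊕-cong (eval-cong s v≈w) (eval-cong t v≈w)
  eval-cong (s ⊃ᶠ t) v≈w = ⊃-cong (eval-cong s v≈w) (eval-cong t v≈w)
  eval-cong (¬ᶠ s)   v≈w = ¬-cong (eval-cong s v≈w)

  eval-isHomomorphism : (v : X → Carrier) →
                        IsHomomorphism (termAlgebra X) A (λ t → eval t v)
  eval-isHomomorphism v = record
    { ≈-homo = λ { refl → ≈.refl }
    ; ∧-homo = λ _ _ → ≈.refl ; ∨-homo = λ _ _ → ≈.refl
    ; ⊗-homo = λ _ _ → ≈.refl ; ⊕-homo = λ _ _ → ≈.refl
    ; ⊃-homo = λ _ _ → ≈.refl ; ¬-homo = λ _ → ≈.refl
    }
    where module ≈ = IsEquivalence ≈-equivalence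

  _⊨_≋_ : Term X → Term X → Set _
  _⊨_≋_ s t = ∀ v → eval s v ≈ eval t v

module _ {A : Algebra a} {B : Algebra b} {h : Algebra.Carrier A → Algebra.Carrier B}
         (h-homo : IsHomomorphism A B h) where
  open Algebra B
  open IsHomomorphism h-homo
  private module ≈ = IsEquivalence ≈-equivalence

  eval-homo : ∀ (t : Term X) v → h (eval A t v) ≈ eval B t (h ∘ v)
  eval-homo (var i)  v = ≈.refl
  eval-homo (s ∧ᶠ t) v = ≈.trans (∧-homo _ _) (∧-cong (eval-homo s v) (eval-homo t v))
  eval-homo (s ∨ᶠ t) v = ≈.trans (∨-homo _ _) (∨-cong (eval-homo s v) (eval-homo t v))
  eval-homo (s ⊗ᶠ t) v = ≈.trans (⊗-homo _ _) (⊗-cong (eval-homo s v) (eval-homo t v))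
  eval-homo (s ⊕ᶠ t) v = ≈.trans (⊕-homo _ _) (⊕-cong (eval-homo s v) (eval-homo t v))
  eval-homo (s ⊃ᶠ t) v = ≈.trans (⊃-homo _ _) (⊃-cong (eval-homo s v) (eval-homo t v))
  eval-homo (¬ᶠ s)   v = ≈.trans (¬-homo _) (¬-cong (eval-homo s v))

eval-var : (t : Term X) → eval (termAlgebra X) t var ≡ t
eval-var (var i)  = refl
eval-var (s ∧ᶠ t) = cong₂ _∧ᶠ_ (eval-var s) (eval-var t)
eval-var (s ∨ᶠ t) = cong₂ _∨ᶠ_ (eval-var s) (eval-var t)
eval-var (s ⊗ᶠ t) = cong₂ _⊗ᶠ_ (eval-var s) (eval-var t)
eval-var (s ⊕ᶠ t) = cong₂ _⊕ᶠ_ (eval-var s) (eval-var t)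
eval-var (s ⊃ᶠ t) = cong₂ _⊃ᶠ_ (eval-var s) (eval-var t)
eval-var (¬ᶠ s)   = cong ¬ᶠ_ (eval-var s)

homomorphism-eval : ∀ (A : Algebra a) {h : Term X → Algebra.Carrier A} →
                    IsHomomorphism (termAlgebra X) A h →
                    ∀ t → Algebra._≈_ A (h t) (eval A t (h ∘ var))
homomorphism-eval A h-homo t =
  ≈.trans (IsHomomorphism.≈-homo h-homo (sym (eval-var t))) (eval-homo h-homo t var)
  where module ≈ = IsEquivalence (Algebra.≈-equivalence A)

∏-projection : ∀ {I : Set ℓ} (A : I → Algebra ℓ) i → IsHomomorphism (∏ I A) (A i) (λ p → p i)
∏-projection A i = record
  { ≈-homo = λ p≈q → p≈q i
  ; ∧-homo = λ _ _ → ≈.refl ; ∨-homo = λ _ _ → ≈.refl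
  ; ⊗-homo = λ _ _ → ≈.refl ; ⊕-homo = λ _ _ → ≈.refl
  ; ⊃-homo = λ _ _ → ≈.refl ; ¬-homo = λ _ → ≈.refl
  }
  where module ≈ = IsEquivalence (Algebra.≈-equivalence (A i))

-- Induction on the generation of the algebra: valuations lift along an epimorphism, an embedding
-- reflects equations, and a product is checked coordinatewise.
V-⊨ : ∀ {K : Pred (Algebra ℓ) k} (s t : Term X) →
      (∀ {A} → K A → _⊨_≋_ A s t) → ∀ {A} → V K A → _⊨_≋_ A s t
V-⊨ s t K⊨ (generator A∈K) = K⊨ A∈K
V-⊨ s t K⊨ (image {A} {B} h h-epi A∈V) v = begin
  eval B s v                 ≈⟨ eval-cong B s h∘w≈v ⟨
  eval B s (h ∘ w)           ≈⟨ eval-homo isHomomorphism s w ⟨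
  h (eval A s w)             ≈⟨ ≈-homo (V-⊨ s t K⊨ A∈V w) ⟩
  h (eval A t w)             ≈⟨ eval-homo isHomomorphism t w ⟩
  eval B t (h ∘ w)           ≈⟨ eval-cong B t h∘w≈v ⟩
  eval B t v                 ∎
  where
  open IsEpimorphism h-epi
  open IsHomomorphism isHomomorphism
  open SetoidReasoning (setoid B)
  -- Surjectivity supplies a function picking preimages, so the valuation lifts without a choice
  -- principle.
  w = λ i → proj₁ (surjective (v i))
  h∘w≈v = λ i → proj₂ (surjective (v i)) (IsEquivalence.refl (Algebra.≈-equivalence A))
V-⊨ s t K⊨ (subalgebra {A} {B} h h-emb B∈V) v = injective (begin
  h (eval A s v)    ≈⟨ eval-homo isHomomorphism s v ⟩
  eval B s (h ∘ v)  ≈⟨ V-⊨ s t K⊨ B∈V (h ∘ v) ⟩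
  eval B t (h ∘ v)  ≈⟨ eval-homo isHomomorphism t v ⟨
  h (eval A t v)    ∎)
  where
  open IsEmbedding h-emb
  open SetoidReasoning (setoid B)
V-⊨ s t K⊨ (product I A A∈V) v i = begin
  eval (∏ I A) s v i            ≈⟨ eval-homo (∏-projection A i) s v ⟩
  eval (A i) s (λ n → v n i)    ≈⟨ V-⊨ s t K⊨ (A∈V i) (λ n → v n i) ⟩
  eval (A i) t (λ n → v n i)    ≈⟨ eval-homo (∏-projection A i) t v ⟨
  eval (∏ I A) t v i            ∎
  where open SetoidReasoning (setoid (A i))

-- Variables of terms and their enumeration.

vars : Term X → List X
vars (var i)  = [ i ]
vars (s ∧ᶠ t) = vars s ++ vars t
vars (s ∨ᶠ t) = vars s ++ vars t
vars (s ⊗ᶠ t) = vars s ++ vars t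
vars (s ⊕ᶠ t) = vars s ++ vars t
vars (s ⊃ᶠ t) = vars s ++ vars t
vars (¬ᶠ s)   = vars s

-- The language has no constants, so every term contains a variable. It serves as the default that
-- extends the finite list `vars t` to an infinite sequence.
leftmost : Term X → X
leftmost (var i)  = i
leftmost (s ∧ᶠ t) = leftmost s
leftmost (s ∨ᶠ t) = leftmost s
leftmost (s ⊗ᶠ t) = leftmost s
leftmost (s ⊕ᶠ t) = leftmost s
leftmost (s ⊃ᶠ t) = leftmost s
leftmost (¬ᶠ s)   = leftmost s

-- The sequence may list further variables as well, so a single `e` can serve a whole set of
-- premises.
Enumerates : {X : Set x} → (ℕ → X) → Term X → Set x
Enumerates e t = ∀ {i} → i ∈ vars t → ∃ λ n → e n ≡ i

enumerate : X → List X → ℕ → X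
enumerate d []       n       = d
enumerate d (i ∷ is) zero    = i
enumerate d (i ∷ is) (suc n) = enumerate d is n

enumerate-∈ : ∀ (d : X) {i is} → i ∈ is → ∃ λ n → enumerate d is n ≡ i
enumerate-∈ d (here refl)  = zero , refl
enumerate-∈ d (there i∈is) = let n , eq = enumerate-∈ d i∈is in suc n , eq

-- The algebra FOUR and its coding by two bits.

∀? : {P : Pred (Four {f}) a} → Decidable P → Dec (∀ v → P v)
∀? P? = map′
  (λ { (p𝖿 , p⊥ , p⊤ , p𝗍) → λ { 𝖿 → p𝖿 ; ⊥ → p⊥ ; ⊤ → p⊤ ; 𝗍 → p𝗍 } })
  (λ p → p 𝖿 , p ⊥ , p ⊤ , p 𝗍)
  (P? 𝖿 ×-dec P? ⊥ ×-dec P? ⊤ ×-dec P? 𝗍)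

_≟_ : DecidableEquality (Four {f})
𝖿 ≟ 𝖿 = yes refl
𝖿 ≟ ⊥ = no λ ()
𝖿 ≟ ⊤ = no λ ()
𝖿 ≟ 𝗍 = no λ ()
⊥ ≟ 𝖿 = no λ ()
⊥ ≟ ⊥ = yes refl
⊥ ≟ ⊤ = no λ ()
⊥ ≟ 𝗍 = no λ ()
⊤ ≟ 𝖿 = no λ ()
⊤ ≟ ⊥ = no λ ()
⊤ ≟ ⊤ = yes refl
⊤ ≟ 𝗍 = no λ ()
𝗍 ≟ 𝖿 = no λ ()
𝗍 ≟ ⊥ = no λ ()
𝗍 ≟ ⊤ = no λ ()
𝗍 ≟ 𝗍 = yes refl

FOUR-isImplicativeBilattice : ImpBiLat (FOUR {f})
FOUR-isImplicativeBilattice {f} = record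
  { isBilattice = record
    { isLatticeₜ = record
      { isEquivalence = ≡-isEquivalence
      ; ∨-comm     = from-yes (∀? λ p → ∀? λ q → (p ∨ q) ≟ (q ∨ p))
      ; ∨-assoc    = from-yes (∀? λ p → ∀? λ q → ∀? λ r → ((p ∨ q) ∨ r) ≟ (p ∨ (q ∨ r)))
      ; ∨-cong     = cong₂ _∨_
      ; ∧-comm     = from-yes (∀? λ p → ∀? λ q → (p ∧ q) ≟ (q ∧ p))
      ; ∧-assoc    = from-yes (∀? λ p → ∀? λ q → ∀? λ r → ((p ∧ q) ∧ r) ≟ (p ∧ (q ∧ r)))
      ; ∧-cong     = cong₂ _∧_
      ; absorptive = from-yes (∀? λ p → ∀? λ q → (p ∨ (p ∧ q)) ≟ p) ,
                     from-yes (∀? λ p → ∀? λ q → (p ∧ (p ∨ q)) ≟ p)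
      }
    ; isLatticeₖ = record
      { isEquivalence = ≡-isEquivalence
      ; ∨-comm     = from-yes (∀? λ p → ∀? λ q → (p ⊕ q) ≟ (q ⊕ p))
      ; ∨-assoc    = from-yes (∀? λ p → ∀? λ q → ∀? λ r → ((p ⊕ q) ⊕ r) ≟ (p ⊕ (q ⊕ r)))
      ; ∨-cong     = cong₂ _⊕_
      ; ∧-comm     = from-yes (∀? λ p → ∀? λ q → (p ⊗ q) ≟ (q ⊗ p))
      ; ∧-assoc    = from-yes (∀? λ p → ∀? λ q → ∀? λ r → ((p ⊗ q) ⊗ r) ≟ (p ⊗ (q ⊗ r)))
      ; ∧-cong     = cong₂ _⊗_
      ; absorptive = from-yes (∀? λ p → ∀? λ q → (p ⊕ (p ⊗ q)) ≟ p) ,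
                     from-yes (∀? λ p → ∀? λ q → (p ⊗ (p ⊕ q)) ≟ p)
      }
    ; ¬-antitoneₜ  = from-yes (∀? λ p → ∀? λ q → ((p ∧ q) ≟ p) →-dec (((¬ q) ∧ (¬ p)) ≟ (¬ q)))
    ; ¬-monotoneₖ  = from-yes (∀? λ p → ∀? λ q → ((p ⊗ q) ≟ p) →-dec (((¬ p) ⊗ (¬ q)) ≟ (¬ p)))
    ; ¬-involutive = from-yes (∀? λ p → (¬ (¬ p)) ≟ p)
    }
  ; ib₁  = from-yes (∀? λ p → ∀? λ q → ((p ⊃ p) ⊃ q) ≟ q)
  ; ib₂∧ = from-yes (∀? λ p → ∀? λ q → ∀? λ r → (p ⊃ (q ⊃ r)) ≟ ((p ∧ q) ⊃ r))
  ; ib₂⊗ = from-yes (∀? λ p → ∀? λ q → ∀? λ r → ((p ∧ q) ⊃ r) ≟ ((p ⊗ q) ⊃ r))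
  ; ib₃  = from-yes (∀? λ p → ∀? λ q → (((p ⊃ q) ⊃ p) ⊃ p) ≟ (p ⊃ p))
  ; ib₄∨ = from-yes (∀? λ p → ∀? λ q → ∀? λ r → ((p ∨ q) ⊃ r) ≟ ((p ⊃ r) ∧ (q ⊃ r)))
  ; ib₄⊕ = from-yes (∀? λ p → ∀? λ q → ∀? λ r → ((p ⊃ r) ∧ (q ⊃ r)) ≟ ((p ⊕ q) ⊃ r))
  ; ib₅  = from-yes (∀? λ p → ∀? λ q → (p ∧ ((p ⊃ q) ⊃ (p ⊗ q))) ≟ p)
  ; ib₆  = from-yes (∀? λ p → ∀? λ q → ∀? λ r → ((¬ (p ⊃ q)) ⊃ r) ≟ ((p ∧ (¬ q)) ⊃ r))
  }
  where open Four-operations {f}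

tr : Four {f} → Bool
tr 𝖿 = false
tr ⊥ = false
tr ⊤ = true
tr 𝗍 = true

-- An element `v` of FOUR is determined by two bits, `tr v` and `tr (¬ v)`; this is the decoding.
value : Bool → Bool → Four {f}
value true  true  = ⊤
value true  false = 𝗍
value false true  = 𝖿
value false false = ⊥

module _ {f : Level} where
  open Four-operations {f}

  tr-value : ∀ β γ → tr (value {f} β γ) ≡ β
  tr-value true  true  = refl
  tr-value true  false = refl
  tr-value false true  = refl
  tr-value false false = refl

  tr-¬value : ∀ β γ → tr (¬ value {f} β γ) ≡ γ
  tr-¬value true  true  = refl
  tr-¬value true  false = refl
  tr-¬value false true  = refl
  tr-¬value false false = refl

  -- On the two bits every operation is Boolean. `∧` and `⊗` agree on the truth bit, as do `∨` and
  -- `⊕`; they differ only on the bit of the negation.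
  tr-∧ : ∀ v w → tr (v ∧ w) ≡ tr v Bool.∧ tr w
  tr-∧ = from-yes (∀? λ v → ∀? λ w → tr (v ∧ w) Bool.≟ (tr v Bool.∧ tr w))

  tr-∨ : ∀ v w → tr (v ∨ w) ≡ tr v Bool.∨ tr w
  tr-∨ = from-yes (∀? λ v → ∀? λ w → tr (v ∨ w) Bool.≟ (tr v Bool.∨ tr w))

  tr-⊗ : ∀ v w → tr (v ⊗ w) ≡ tr v Bool.∧ tr w
  tr-⊗ = from-yes (∀? λ v → ∀? λ w → tr (v ⊗ w) Bool.≟ (tr v Bool.∧ tr w))

  tr-⊕ : ∀ v w → tr (v ⊕ w) ≡ tr v Bool.∨ tr w
  tr-⊕ = from-yes (∀? λ v → ∀? λ w → tr (v ⊕ w) Bool.≟ (tr v Bool.∨ tr w))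

  tr-⊃ : ∀ v w → tr (v ⊃ w) ≡ Bool.not (tr v) Bool.∨ tr w
  tr-⊃ = from-yes (∀? λ v → ∀? λ w → tr (v ⊃ w) Bool.≟ (Bool.not (tr v) Bool.∨ tr w))

  tr-¬∧ : ∀ v w → tr (¬ (v ∧ w)) ≡ tr (¬ v) Bool.∨ tr (¬ w)
  tr-¬∧ = from-yes (∀? λ v → ∀? λ w → tr (¬ (v ∧ w)) Bool.≟ (tr (¬ v) Bool.∨ tr (¬ w)))

  tr-¬∨ : ∀ v w → tr (¬ (v ∨ w)) ≡ tr (¬ v) Bool.∧ tr (¬ w)
  tr-¬∨ = from-yes (∀? λ v → ∀? λ w → tr (¬ (v ∨ w)) Bool.≟ (tr (¬ v) Bool.∧ tr (¬ w)))

  tr-¬⊗ : ∀ v w → tr (¬ (v ⊗ w)) ≡ tr (¬ v) Bool.∧ tr (¬ w)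
  tr-¬⊗ = from-yes (∀? λ v → ∀? λ w → tr (¬ (v ⊗ w)) Bool.≟ (tr (¬ v) Bool.∧ tr (¬ w)))

  tr-¬⊕ : ∀ v w → tr (¬ (v ⊕ w)) ≡ tr (¬ v) Bool.∨ tr (¬ w)
  tr-¬⊕ = from-yes (∀? λ v → ∀? λ w → tr (¬ (v ⊕ w)) Bool.≟ (tr (¬ v) Bool.∨ tr (¬ w)))

  tr-¬⊃ : ∀ v w → tr (¬ (v ⊃ w)) ≡ tr v Bool.∧ tr (¬ w)
  tr-¬⊃ = from-yes (∀? λ v → ∀? λ w → tr (¬ (v ⊃ w)) Bool.≟ (tr v Bool.∧ tr (¬ w)))

  tr-⊃-refl : ∀ {v w} → v ≡ w → tr (v ⊃ w) ≡ true
  tr-⊃-refl {v} refl = from-yes (∀? λ u → tr (u ⊃ u) Bool.≟ true) v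

Tr⇒tr : ∀ {v} → Tr v → tr v ≡ true
Tr⇒tr ⊤∈Tr = refl
Tr⇒tr 𝗍∈Tr = refl

tr⇒Tr : ∀ {v} → tr v ≡ true → Tr v
tr⇒Tr {⊤} _ = ⊤∈Tr
tr⇒Tr {𝗍} _ = 𝗍∈Tr

-- De Morgan laws in bilattices.

module _ {_≈_ : Rel X a} {_≤₁_ _≤₂_ : Rel X b} {_∧₁_ _∧₂_ : X → X → X}
         (M₁ : IsMeetSemilattice _≈_ _≤₁_ _∧₁_) (M₂ : IsMeetSemilattice _≈_ _≤₂_ _∧₂_)
         {h : X → X} (h-involutive : ∀ p → h (h p) ≈ p)
         (h-mono₁₂ : ∀ {p q} → p ≤₁ q → h p ≤₂ h q) (h-mono₂₁ : ∀ {p q} → p ≤₂ q → h p ≤₁ h q) where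
  private
    module M₁ = IsMeetSemilattice M₁
    module M₂ = IsMeetSemilattice M₂

  -- An involution that is monotone both ways is an order isomorphism and so carries meets to meets.
  -- With the two orders taken dual or equal, this covers all four De Morgan laws.
  involution-preserves-meets : ∀ p q → h (p ∧₁ q) ≈ (h p ∧₂ h q)
  involution-preserves-meets p q = M₂.antisym
    (M₂.∧-greatest (h-mono₁₂ (M₁.x∧y≤x p q)) (h-mono₁₂ (M₁.x∧y≤y p q)))
    (M₂.trans (M₂.reflexive (M₂.Eq.sym (h-involutive _)))
      (h-mono₁₂ (M₁.∧-greatest
        (M₁.trans (h-mono₂₁ (M₂.x∧y≤x _ _)) (M₁.reflexive (h-involutive p)))
        (M₁.trans (h-mono₂₁ (M₂.x∧y≤y _ _)) (M₁.reflexive (h-involutive q))))))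

module Bilattice {A : Algebra ℓ} (isBilattice : IsBilattice A) where
  open Algebra A
  open IsBilattice isBilattice
  open IsEquivalence ≈-equivalence renaming (refl to ≈-refl; sym to ≈-sym; trans to ≈-trans)

  latticeₜ latticeₖ : Lattice ℓ ℓ
  latticeₜ = record { isLattice = isLatticeₜ }
  latticeₖ = record { isLattice = isLatticeₖ }

  module T = LatticeProperties latticeₜ
  module K = LatticeProperties latticeₖ
  module ∧∨ = IsLattice isLatticeₜ
  module ⊗⊕ = IsLattice isLatticeₖ
  -- In the dual lattices joins become meets.
  module T∂ = LatticeProperties T.∧-∨-lattice
  module K∂ = LatticeProperties K.∧-∨-lattice

  meet⇒join : ∀ {p q} → p ∧ q ≈ p → q ∨ p ≈ q
  meet⇒join p≤q = ≈-trans (∨-cong ≈-refl (≈-trans (≈-sym p≤q) (∧∨.∧-comm _ _))) (∧∨.∨-absorbs-∧ _ _)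

  join⇒meet : ∀ {p q} → q ∨ p ≈ q → p ∧ q ≈ p
  join⇒meet q≥p = ≈-trans (∧-cong ≈-refl (≈-trans (≈-sym q≥p) (∧∨.∨-comm _ _))) (∧∨.∧-absorbs-∨ _ _)

  meet⇒joinₖ : ∀ {p q} → p ⊗ q ≈ p → q ⊕ p ≈ q
  meet⇒joinₖ p≤q = ≈-trans (⊕-cong ≈-refl (≈-trans (≈-sym p≤q) (⊗⊕.∧-comm _ _))) (⊗⊕.∨-absorbs-∧ _ _)

  join⇒meetₖ : ∀ {p q} → q ⊕ p ≈ q → p ⊗ q ≈ p
  join⇒meetₖ q≥p = ≈-trans (⊗-cong ≈-refl (≈-trans (≈-sym q≥p) (⊗⊕.∨-comm _ _))) (⊗⊕.∧-absorbs-∨ _ _)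

  ¬-∧ : ∀ p q → ¬ (p ∧ q) ≈ ¬ p ∨ ¬ q
  ¬-∧ = involution-preserves-meets
    T.∧-isOrderTheoreticMeetSemilattice T∂.∧-isOrderTheoreticMeetSemilattice ¬-involutive
    (λ p≤q → ≈-sym (meet⇒join (¬-antitoneₜ _ _ (≈-sym p≤q))))
    (λ p≥q → ≈-sym (¬-antitoneₜ _ _ (join⇒meet (≈-sym p≥q))))

  ¬-∨ : ∀ p q → ¬ (p ∨ q) ≈ ¬ p ∧ ¬ q
  ¬-∨ = involution-preserves-meets
    T∂.∧-isOrderTheoreticMeetSemilattice T.∧-isOrderTheoreticMeetSemilattice ¬-involutive
    (λ p≥q → ≈-sym (¬-antitoneₜ _ _ (join⇒meet (≈-sym p≥q))))
    (λ p≤q → ≈-sym (meet⇒join (¬-antitoneₜ _ _ (≈-sym p≤q))))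

  ¬-⊗ : ∀ p q → ¬ (p ⊗ q) ≈ ¬ p ⊗ ¬ q
  ¬-⊗ = involution-preserves-meets
    K.∧-isOrderTheoreticMeetSemilattice K.∧-isOrderTheoreticMeetSemilattice ¬-involutive
    ¬-mono ¬-mono
    where
    ¬-mono : ∀ {p q} → p ≈ p ⊗ q → ¬ p ≈ ¬ p ⊗ ¬ q
    ¬-mono p≤q = ≈-sym (¬-monotoneₖ _ _ (≈-sym p≤q))

  ¬-⊕ : ∀ p q → ¬ (p ⊕ q) ≈ ¬ p ⊕ ¬ q
  ¬-⊕ = involution-preserves-meets
    K∂.∧-isOrderTheoreticMeetSemilattice K∂.∧-isOrderTheoreticMeetSemilattice ¬-involutive
    ¬-mono ¬-mono
    where
    ¬-mono : ∀ {p q} → p ≈ p ⊕ q → ¬ p ≈ ¬ p ⊕ ¬ q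
    ¬-mono p≥q = ≈-sym (meet⇒joinₖ (¬-monotoneₖ _ _ (join⇒meetₖ (≈-sym p≥q))))

-- Designated elements and implicative filters.

module ImplicativeBilattice {A : Algebra ℓ} (isIB : ImpBiLat A) where
  open Algebra A
  open IsImplicativeBilattice isIB
  open IsBilattice isBilattice
  open Bilattice isBilattice public
  open IsEquivalence ≈-equivalence renaming (refl to ≈-refl; sym to ≈-sym; trans to ≈-trans)
  open SetoidReasoning (setoid A)

  infix 4 _≤_
  _≤_ : Rel Carrier ℓ
  _≤_ = _≤ₜ_ A

  Designated : Pred Carrier ℓ
  Designated p = p ⊃ p ≈ p

  designated-resp : Designated Respects _≈_
  designated-resp p≈q dp = ≈-trans (⊃-cong (≈-sym p≈q) (≈-sym p≈q)) (≈-trans dp p≈q)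

  designated-⊃ : ∀ {p} → Designated p → ∀ q → p ⊃ q ≈ q
  designated-⊃ {p} dp q = ≈-trans (⊃-cong (≈-sym dp) ≈-refl) (ib₁ p q)

  designated-mp : ∀ {p q} → Designated (p ⊃ q) → Designated p → Designated q
  designated-mp dpq dp = designated-resp (designated-⊃ dp _) dpq

  designated-refl : ∀ p → Designated (p ⊃ p)
  designated-refl p = ib₁ p (p ⊃ p)

  -- A designated antecedent can be inserted and deleted freely. With `p` put in front of `q ⊃ q`,
  -- IB2 and `p ≤ q` collapse the result to `q`.
  designated-upward : ∀ {p q} → p ≤ q → Designated p → Designated q
  designated-upward {p} {q} p≤q dp = begin
    q ⊃ q          ≈⟨ designated-⊃ dp _ ⟨
    p ⊃ (q ⊃ q)    ≈⟨ ib₂∧ p q q ⟩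
    (p ∧ q) ⊃ q    ≈⟨ ⊃-cong p≤q ≈-refl ⟩
    p ⊃ q          ≈⟨ designated-⊃ dp q ⟩
    q              ∎

  private module ≤ = IsMeetSemilattice T.∧-isOrderTheoreticMeetSemilattice

  ∧-≤ˡ : ∀ p q → p ∧ q ≤ p
  ∧-≤ˡ p q = ≈-sym (≤.x∧y≤x p q)

  ∧-≤ʳ : ∀ p q → p ∧ q ≤ q
  ∧-≤ʳ p q = ≈-sym (≤.x∧y≤y p q)

  ≤-trans : ∀ {p q r} → p ≤ q → q ≤ r → p ≤ r
  ≤-trans p≤q q≤r = ≈-sym (≤.trans (≈-sym p≤q) (≈-sym q≤r))

  ≤-antisym : ∀ {p q} → p ≤ q → q ≤ p → p ≈ q
  ≤-antisym p≤q q≤p = ≤.antisym (≈-sym p≤q) (≈-sym q≤p)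

  ⊃-antitoneˡ : ∀ {p q} r → p ≤ q → q ⊃ r ≤ p ⊃ r
  ⊃-antitoneˡ {p} {q} r p≤q = begin
    (q ⊃ r) ∧ (p ⊃ r)  ≈⟨ ib₄∨ q p r ⟨
    (q ∨ p) ⊃ r        ≈⟨ ⊃-cong (meet⇒join p≤q) ≈-refl ⟩
    q ⊃ r              ∎

  ≤⇒designated : ∀ {p q} → p ≤ q → Designated (p ⊃ q)
  ≤⇒designated {q = q} p≤q = designated-upward (⊃-antitoneˡ q p≤q) (designated-refl q)

  curry-∧ : ∀ {p q r} → Designated ((p ∧ q) ⊃ r) → Designated (p ⊃ (q ⊃ r))
  curry-∧ = designated-resp (≈-sym (ib₂∧ _ _ _))

  designated-K : ∀ p q → Designated (p ⊃ (q ⊃ p))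
  designated-K p q = curry-∧ (≤⇒designated (∧-≤ˡ p q))

  designated⇒≤⊗ : ∀ {p q} → Designated (p ⊃ q) → p ≤ p ⊗ q
  designated⇒≤⊗ {p} {q} dpq = ≈-trans (∧-cong ≈-refl (≈-sym (designated-⊃ dpq _))) (ib₅ p q)

  -- Implicative filters: upward closure, closure under `∧` and respect for `≈` follow from these
  -- two conditions.
  record IsFilter (D : Pred Carrier ℓ) : Set ℓ where
    field
      designated : ∀ {p} → Designated p → D p
      mp         : ∀ {p q} → D (p ⊃ q) → D p → D q

  -- For `mp`, IB5 turns a designated `d ⊃ p` into `d ≤ d ⊗ p`. By IB2 the other premise is
  -- `(d ⊗ p) ⊃ q`, and antitonicity on the left makes `d ⊃ q` designated.
  principal-isFilter : ∀ d → IsFilter (λ p → Designated (d ⊃ p))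
  principal-isFilter d = record
    { designated = λ {p} dp → designated-mp (designated-K p d) dp
    ; mp         = λ {p} {q} d⊃p⊃q d⊃p → designated-upward
        (⊃-antitoneˡ q (designated⇒≤⊗ d⊃p))
        (designated-resp (≈-trans (ib₂∧ d p q) (ib₂⊗ d p q)) d⊃p⊃q)
    }

  -- Proved inside the principal filter of the conjunction of the three antecedents, where modus
  -- ponens is already available; currying twice discharges them.
  designated-S : ∀ d p q → Designated ((d ⊃ (p ⊃ q)) ⊃ ((d ⊃ p) ⊃ (d ⊃ q)))
  designated-S d p q = curry-∧ (curry-∧ (mp (mp d⊃p⊃q d′) (mp d⊃p d′)))
    where
    premises = (d ⊃ (p ⊃ q)) ∧ (d ⊃ p)
    open IsFilter (principal-isFilter (premises ∧ d))
    d⊃p⊃q = ≤⇒designated (≤-trans (∧-≤ˡ premises d) (∧-≤ˡ _ _))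
    d⊃p   = ≤⇒designated (≤-trans (∧-≤ˡ premises d) (∧-≤ʳ _ _))
    d′    = ≤⇒designated (∧-≤ʳ premises d)

  designated-peirce : ∀ p q → Designated (((p ⊃ q) ⊃ p) ⊃ p)
  designated-peirce p q = designated-resp (≈-sym (ib₃ p q)) (designated-refl p)

  -- For a filter `D` this is the filter generated by `D` and `x`. Iterating it by means of `given`
  -- and `weaken` imitates natural deduction under hypotheses.
  ⟪_⟫_ : Pred Carrier ℓ → Carrier → Pred Carrier ℓ
  (⟪ D ⟫ x) p = D (x ⊃ p)

  module Filter {D : Pred Carrier ℓ} (isFilter : IsFilter D) where
    open IsFilter isFilter public

    ≤-closed : ∀ {p q} → p ≤ q → D p → D q
    ≤-closed p≤q = mp (designated (≤⇒designated p≤q))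

    resp : D Respects _≈_
    resp {p} {q} p≈q = ≤-closed (≈-trans (∧-cong ≈-refl (≈-sym p≈q)) (T.∧-idem p))

    weaken : ∀ {p} q → D p → D (q ⊃ p)
    weaken q = mp (designated (designated-K _ q))

    given : ∀ x → IsFilter (⟪ D ⟫ x)
    given x = record
      { designated = λ dp → weaken x (designated dp)
      ; mp         = λ x⊃p⊃q → mp (mp (designated (designated-S x _ _)) x⊃p⊃q)
      }

    assumption : ∀ x → D (x ⊃ x)
    assumption x = designated (designated-refl x)

    chain-⊃ : ∀ {p q r} → D (p ⊃ q) → D (q ⊃ r) → D (p ⊃ r)
    chain-⊃ {p} p⊃q q⊃r = IsFilter.mp (given p) (weaken p q⊃r) p⊃q

    pair : ∀ {p q} → D p → D q → D (p ∧ q)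
    pair {p} {q} Dp = mp (mp (designated (curry-∧ (designated-refl (p ∧ q)))) Dp)

    peirce : ∀ {p q} → D ((p ⊃ q) ⊃ p) → D p
    peirce = mp (designated (designated-peirce _ _))

  -- The four implications say p ≤ p ⊗ q and q ≤ p ⊗ q, and after negating that
  -- p ⊗ q lies below p and q.
  ⊃-antisym : ∀ {p q} → Designated (p ⊃ q) → Designated (q ⊃ p) →
              Designated (¬ p ⊃ ¬ q) → Designated (¬ q ⊃ ¬ p) → p ≈ q
  ⊃-antisym {p} {q} p⊃q q⊃p ¬p⊃¬q ¬q⊃¬p = ≈-trans (⊗-collapse p⊃q ¬p⊃¬q)
    (≈-trans (⊗⊕.∧-comm p q) (≈-sym (⊗-collapse q⊃p ¬q⊃¬p)))
    where
    ⊗-collapse : ∀ {p q} → Designated (p ⊃ q) → Designated (¬ p ⊃ ¬ q) → p ≈ p ⊗ q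
    ⊗-collapse {p} {q} p⊃q ¬p⊃¬q = ≤-antisym (designated⇒≤⊗ p⊃q) (begin
      (p ⊗ q) ∧ p                    ≈⟨ ∧-cong (¬-involutive _) (¬-involutive p) ⟨
      ¬ (¬ (p ⊗ q)) ∧ ¬ (¬ p)        ≈⟨ ¬-antitoneₜ _ _ ¬p≤¬⊗ ⟩
      ¬ (¬ (p ⊗ q))                  ≈⟨ ¬-involutive _ ⟩
      p ⊗ q                          ∎)
      where
      ¬p≤¬⊗ : ¬ p ≤ ¬ (p ⊗ q)
      ¬p≤¬⊗ = ≈-trans (∧-cong ≈-refl (¬-⊗ p q)) (designated⇒≤⊗ ¬p⊃¬q)

  -- Relative double negation p ↦ (p ⊃ c) ⊃ c: there is no falsum, so c plays its part.
  stable : Pred Carrier ℓ → Carrier → Pred Carrier ℓ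
  stable D c p = D ((p ⊃ c) ⊃ c)

  module _ {D : Pred Carrier ℓ} (isFilter : IsFilter D) (c : Carrier) where
    open Filter isFilter

    stable-isFilter : IsFilter (stable D c)
    stable-isFilter = record
      { designated = λ {p} dp → Filter.mp (given (p ⊃ c)) (assumption (p ⊃ c)) (weaken (p ⊃ c) (designated dp))
      ; mp         = stable-mp
      }
      where
      stable-mp : ∀ {p q} → stable D c (p ⊃ q) → stable D c p → stable D c q
      -- Under the hypotheses `q ⊃ c` and `p ⊃ q`, chaining gives `p ⊃ c` and then `c`. Discharging
      -- `p ⊃ q` gives `(p ⊃ q) ⊃ c`, to which the first premise applies.
      stable-mp {p} {q} ¬¬p⊃q ¬¬p = E.mp (weaken _ ¬¬p⊃q)
        (E[p⊃q].mp (E.weaken (p ⊃ q) (weaken (q ⊃ c) ¬¬p))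
          (E[p⊃q].chain-⊃ (E.assumption (p ⊃ q)) (E.weaken (p ⊃ q) (assumption (q ⊃ c)))))
        where
        module E = Filter (given (q ⊃ c))
        module E[p⊃q] = Filter (E.given (p ⊃ q))

    -- This recovers ex falso for `c`. Assume `(p ⊃ q) ⊃ c`; by Peirce's law `c` may be derived from
    -- `c ⊃ q`, which chains with `p ⊃ c` to `p ⊃ q` and so gives `c`.
    stable-refutes : ∀ {p} → D (p ⊃ c) → ∀ q → stable D c (p ⊃ q)
    stable-refutes {p} p⊃c q = E.peirce (E[c⊃q].mp (E.weaken (c ⊃ q) (assumption ((p ⊃ q) ⊃ c)))
        (E[c⊃q].chain-⊃ (E.weaken (c ⊃ q) (weaken _ p⊃c)) (E.assumption (c ⊃ q))))
      where
      module E = Filter (given ((p ⊃ q) ⊃ c))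
      module E[c⊃q] = Filter (E.given (c ⊃ q))

  -- Literals and valuations in FOUR.

  -- Without a falsum, refuting `p` means that `p` implies everything.
  data Literal (D : Pred Carrier ℓ) : Bool → Pred Carrier ℓ where
    asserted : ∀ {p} → D p → Literal D true p
    refuted  : ∀ {p} → (∀ q → D (p ⊃ q)) → Literal D false p

  Decided : Pred Carrier ℓ → Pred Carrier ℓ
  Decided D p = ∃ λ β → Literal D β p

  module _ {D : Pred Carrier ℓ} (isFilter : IsFilter D) where
    open Filter isFilter

    -- A literal depends only on the behaviour of `p` as an antecedent. Through IB2, IB4 and IB6
    -- this moves literals from `∧` to `⊗`, from `∨` to `⊕`, and from `p ∧ ¬ q` to `¬ (p ⊃ q)`.
    literal-transfer : ∀ {β p q} → (∀ r → p ⊃ r ≈ q ⊃ r) → Literal D β p → Literal D β q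
    literal-transfer p~q (asserted Dp) = asserted (mp (resp (≈-sym (p~q _)) (assumption _)) Dp)
    literal-transfer p~q (refuted ¬p)  = refuted λ r → resp (p~q r) (¬p r)

    literal-resp : ∀ {β p q} → p ≈ q → Literal D β p → Literal D β q
    literal-resp p≈q = literal-transfer (λ r → ⊃-cong p≈q ≈-refl)

    literal-∧ : ∀ {β γ p q} → Literal D β p → Literal D γ q → Literal D (β Bool.∧ γ) (p ∧ q)
    literal-∧ (asserted Dp) (asserted Dq) = asserted (pair Dp Dq)
    literal-∧ (asserted Dp) (refuted ¬q)  =
      refuted λ r → chain-⊃ (designated (≤⇒designated (∧-≤ʳ _ _))) (¬q r)
    literal-∧ (refuted ¬p)  _             =
      refuted λ r → chain-⊃ (designated (≤⇒designated (∧-≤ˡ _ _))) (¬p r)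

    literal-∨ : ∀ {β γ p q} → Literal D β p → Literal D γ q → Literal D (β Bool.∨ γ) (p ∨ q)
    literal-∨ {p = p} {q} (asserted Dp) _ = asserted (≤-closed (∧∨.∧-absorbs-∨ p q) Dp)
    literal-∨ {p = p} {q} (refuted ¬p) (asserted Dq) =
      asserted (≤-closed (≈-trans (∧-cong ≈-refl (∧∨.∨-comm p q)) (∧∨.∧-absorbs-∨ q p)) Dq)
    literal-∨ {p = p} {q} (refuted ¬p) (refuted ¬q) =
      refuted λ r → resp (≈-sym (ib₄∨ p q r)) (pair (¬p r) (¬q r))

    literal-⊃ : ∀ {β γ p q} → Literal D β p → Literal D γ q → Literal D (Bool.not β Bool.∨ γ) (p ⊃ q)
    literal-⊃ (refuted ¬p)  _             = asserted (¬p _)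
    literal-⊃ (asserted _)  (asserted Dq) = asserted (weaken _ Dq)
    literal-⊃ (asserted Dp) (refuted ¬q)  = refuted λ r →
      Filter.chain-⊃ isFilter (Filter.mp (given _) (assumption _) (weaken _ Dp)) (¬q r)

  record Represents (D : Pred Carrier ℓ) (p : Carrier) (v : Four {f}) : Set ℓ where
    constructor represents
    field
      truth   : Literal D (tr v) p
      falsity : Literal D (tr (Four-operations.¬_ v)) (¬ p)

  module _ {D : Pred Carrier ℓ} (isFilter : IsFilter D) {f : Level} where
    private
      module F = Four-operations {f}
      variable
        p q : Carrier
        v w : Four {f}

      read : ∀ {β γ p} → γ ≡ β → Literal D β p → Literal D γ p
      read γ≡β = subst (λ β → Literal D β _) (sym γ≡β)

    represents-¬ : Represents D p v → Represents D (¬ p) (F.¬ v)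
    represents-¬ {p} {v} (represents +p -p) = represents -p
      (literal-resp isFilter (≈-sym (¬-involutive p)) (read (cong tr (FOUR.¬-involutive v)) +p))
      where module FOUR = IsBilattice (IsImplicativeBilattice.isBilattice FOUR-isImplicativeBilattice)

    represents-∧ : Represents D p v → Represents D q w → Represents D (p ∧ q) (v F.∧ w)
    represents-∧ {p} {v} {q} {w} (represents +p -p) (represents +q -q) = represents
      (read (tr-∧ v w) (literal-∧ isFilter +p +q))
      (literal-resp isFilter (≈-sym (¬-∧ p q)) (read (tr-¬∧ v w) (literal-∨ isFilter -p -q)))

    represents-∨ : Represents D p v → Represents D q w → Represents D (p ∨ q) (v F.∨ w)
    represents-∨ {p} {v} {q} {w} (represents +p -p) (represents +q -q) = represents
      (read (tr-∨ v w) (literal-∨ isFilter +p +q))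
      (literal-resp isFilter (≈-sym (¬-∨ p q)) (read (tr-¬∨ v w) (literal-∧ isFilter -p -q)))

    represents-⊗ : Represents D p v → Represents D q w → Represents D (p ⊗ q) (v F.⊗ w)
    represents-⊗ {p} {v} {q} {w} (represents +p -p) (represents +q -q) = represents
      (literal-transfer isFilter (ib₂⊗ p q) (read (tr-⊗ v w) (literal-∧ isFilter +p +q)))
      (literal-resp isFilter (≈-sym (¬-⊗ p q))
        (literal-transfer isFilter (ib₂⊗ _ _) (read (tr-¬⊗ v w) (literal-∧ isFilter -p -q))))

    represents-⊕ : Represents D p v → Represents D q w → Represents D (p ⊕ q) (v F.⊕ w)
    represents-⊕ {p} {v} {q} {w} (represents +p -p) (represents +q -q) = represents
      (literal-transfer isFilter (∨~⊕ p q) (read (tr-⊕ v w) (literal-∨ isFilter +p +q)))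
      (literal-resp isFilter (≈-sym (¬-⊕ p q))
        (literal-transfer isFilter (∨~⊕ _ _) (read (tr-¬⊕ v w) (literal-∨ isFilter -p -q))))
      where
      ∨~⊕ : ∀ p q r → (p ∨ q) ⊃ r ≈ (p ⊕ q) ⊃ r
      ∨~⊕ p q r = ≈-trans (ib₄∨ p q r) (ib₄⊕ p q r)

    represents-⊃ : Represents D p v → Represents D q w → Represents D (p ⊃ q) (v F.⊃ w)
    represents-⊃ {p} {v} {q} {w} (represents +p -p) (represents +q -q) = represents
      (read (tr-⊃ v w) (literal-⊃ isFilter +p +q))
      (literal-transfer isFilter (λ r → ≈-sym (ib₆ p q r)) (read (tr-¬⊃ v w) (literal-∧ isFilter +p -q)))

    -- Only variables that occur have to be represented, which is why deciding countably many
    -- elements and their negations is enough.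
    represents-eval : ∀ (t : Term X) {v : X → Carrier} {w : X → Four {f}} →
                      (∀ {i} → i ∈ vars t → Represents D (v i) (w i)) →
                      Represents D (eval A t v) (eval FOUR t w)
    represents-eval (var i)  vw = vw (here refl)
    represents-eval (s ∧ᶠ t) vw = represents-∧ (represents-eval s (vw ∘ ∈-++⁺ˡ)) (represents-eval t (vw ∘ ∈-++⁺ʳ _))
    represents-eval (s ∨ᶠ t) vw = represents-∨ (represents-eval s (vw ∘ ∈-++⁺ˡ)) (represents-eval t (vw ∘ ∈-++⁺ʳ _))
    represents-eval (s ⊗ᶠ t) vw = represents-⊗ (represents-eval s (vw ∘ ∈-++⁺ˡ)) (represents-eval t (vw ∘ ∈-++⁺ʳ _))
    represents-eval (s ⊕ᶠ t) vw = represents-⊕ (represents-eval s (vw ∘ ∈-++⁺ˡ)) (represents-eval t (vw ∘ ∈-++⁺ʳ _))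
    represents-eval (s ⊃ᶠ t) vw = represents-⊃ (represents-eval s (vw ∘ ∈-++⁺ˡ)) (represents-eval t (vw ∘ ∈-++⁺ʳ _))
    represents-eval (¬ᶠ s)   vw = represents-¬ (represents-eval s vw)

  -- Separating an undesignated element by a filter.

  module Lindenbaum (em : ExcludedMiddle ℓ) {c : Carrier} (c-undesignated : not Designated c) (e : ℕ → Carrier) where

    -- Each stage is coded by one element `d`, to which only `x ⊃ c` is ever added. If that would
    -- yield `c`, currying shows that `d` implies `(x ⊃ c) ⊃ c`, so `x` is already asserted in the
    -- `stable` sense.
    extend : Carrier → Carrier → Carrier
    extend x d with em {Designated ((d ∧ (x ⊃ c)) ⊃ c)}
    ... | yes _ = d
    ... | no  _ = d ∧ (x ⊃ c)

    extend-≤ : ∀ x d → extend x d ≤ d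
    extend-≤ x d with em {Designated ((d ∧ (x ⊃ c)) ⊃ c)}
    ... | yes _ = T.∧-idem d
    ... | no  _ = ∧-≤ˡ _ _

    extend-consistent : ∀ x d → not Designated (d ⊃ c) → not Designated (extend x d ⊃ c)
    extend-consistent x d consistent with em {Designated ((d ∧ (x ⊃ c)) ⊃ c)}
    ... | yes _ = consistent
    ... | no ¬p = ¬p

    extend-decides : ∀ x d → Designated (extend x d ⊃ ((x ⊃ c) ⊃ c)) ⊎ Designated (extend x d ⊃ (x ⊃ c))
    extend-decides x d with em {Designated ((d ∧ (x ⊃ c)) ⊃ c)}
    ... | yes p = inj₁ (curry-∧ p)
    ... | no  _ = inj₂ (≤⇒designated (∧-≤ʳ _ _))

    chain : ℕ → Carrier
    -- `c ⊃ c` is designated, so stage zero implies only designated elements and its consistency is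
    -- the assumption on `c`.
    chain zero    = c ⊃ c
    chain (suc n) = extend (¬ e n) (extend (e n) (chain n))

    chain-antitone : ∀ {m n} → m ≤′ n → chain n ≤ chain m
    chain-antitone ≤′-refl       = T.∧-idem _
    chain-antitone (≤′-step m≤n) = ≤-trans (extend-≤ _ _) (≤-trans (extend-≤ _ _) (chain-antitone m≤n))

    chain-consistent : ∀ n → not Designated (chain n ⊃ c)
    chain-consistent zero    d = c-undesignated (designated-mp d (designated-refl c))
    chain-consistent (suc n)   = extend-consistent _ _ (extend-consistent _ _ (chain-consistent n))

    -- Stages decrease, so their principal filters increase; modus ponens holds in the union by
    -- passing to the later of two stages.
    Limit : Pred Carrier ℓ
    Limit p = ∃ λ n → Designated (chain n ⊃ p)

    limit-isFilter : IsFilter Limit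
    limit-isFilter = record
      { designated = λ dp → zero , IsFilter.designated (principal-isFilter _) dp
      ; mp         = λ { (m , d₁) (n , d₂) → m ⊔ n , IsFilter.mp (principal-isFilter _)
          (designated-upward (⊃-antitoneˡ _ (chain-antitone (≤⇒≤′ (m≤m⊔n m n)))) d₁)
          (designated-upward (⊃-antitoneˡ _ (chain-antitone (≤⇒≤′ (m≤n⊔m m n)))) d₂) }
      }

    limit-decides : ∀ {p n d} → chain n ≤ extend p d → Decided (stable Limit c) p
    limit-decides {p} {n} {d} n≤ with extend-decides p d
    ... | inj₁ ¬¬p = true , asserted (n , designated-upward (⊃-antitoneˡ _ n≤) ¬¬p)
    ... | inj₂ ¬p  = false , refuted (stable-refutes limit-isFilter c (n , designated-upward (⊃-antitoneˡ _ n≤) ¬p))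

  record Separator (e : ℕ → Carrier) (c : Carrier) : Set (Level.suc ℓ) where
    field
      D         : Pred Carrier ℓ
      isFilter  : IsFilter D
      excludes  : not D c
      decides   : ∀ n → Decided D (e n)
      decides-¬ : ∀ n → Decided D (¬ e n)

  separate : ExcludedMiddle ℓ → ∀ e {c} → not Designated c → Separator e c
  separate em e {c} c-undesignated = record
    { D         = stable Limit c
    ; isFilter  = stable-isFilter limit-isFilter c
    -- Membership of `c` means that some stage implies `(c ⊃ c) ⊃ c`, which is `c` by IB1.
    ; excludes  = λ { (n , d) → chain-consistent n (designated-resp (⊃-cong ≈-refl (ib₁ c c)) d) }
    -- Stage `suc n` extends first for `e n` and then for `¬ e n`: it lies one extension below the
    -- element that decides `e n`, and itself decides `¬ e n`.
    ; decides   = λ n → limit-decides {n = suc n} (extend-≤ _ _)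
    ; decides-¬ = λ n → limit-decides {n = suc n} (T.∧-idem _)
    }
    where open Lindenbaum em c-undesignated e

  module _ (em : ExcludedMiddle ℓ) {D : Pred Carrier ℓ} where

    -- Excluded middle reads both bits off from membership. On undecided elements a `false` bit
    -- carries no refutation, so `represents-truthValue` asks for both decisions.
    truthValue : Carrier → Four {f}
    truthValue p = value (does (em {D p})) (does (em {D (¬ p)}))

    decided-literal : ∀ {p} → Decided D p → Literal D (does (em {D p})) p
    decided-literal {p} decided with em {D p}
    decided-literal _                      | yes Dp = asserted Dp
    decided-literal (true  , asserted Dp)  | no ¬Dp = contradiction Dp ¬Dp
    decided-literal (false , refuted ¬p)   | no _   = refuted ¬p

    represents-truthValue : ∀ {p} → Decided D p → Decided D (¬ p) → Represents D p (truthValue {f} p)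
    represents-truthValue {p = p} +p -p = represents
      (subst (λ β → Literal D β p) (sym (tr-value _ (does (em {D (¬ p)})))) (decided-literal +p))
      (subst (λ β → Literal D β (¬ p)) (sym (tr-¬value (does (em {D p})) _)) (decided-literal -p))

  -- Excluding `c` is what consistency amounts to: a refuted member of `D` would imply `c`.
  represents-tr : ∀ {D c p} {v : Four {f}} → IsFilter D → not D c → Represents D p v → D p → tr v ≡ true
  represents-tr {v = v} isFilter c∉D (represents +p _) Dp with tr v | +p
  ... | true  | _          = refl
  ... | false | refuted ¬p = contradiction (IsFilter.mp isFilter (¬p _) Dp) c∉D

  tr-represents : ∀ {D p} {v : Four {f}} → Represents D p v → tr v ≡ true → D p
  tr-represents {v = v} (represents +p _) v∈Tr with tr v | +p
  tr-represents _ refl | true | asserted Dp = Dp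

  -- Completeness with respect to FOUR.

  -- If `φ` took an undesignated value, the filter separating it would give a valuation in FOUR that
  -- verifies `Γ` but not `φ`. One filter decides the variables of all premises, so `Γ` may be
  -- infinite and no compactness argument enters.
  consequence : ∀ {f} → ExcludedMiddle ℓ → {X : Set x} (Γ : Pred (Term X) ℓ) (φ : Term X) (e : ℕ → X) →
    (∀ γ → Γ γ → Enumerates e γ) → Enumerates e φ →
    (∀ (w : X → Four {f}) → (∀ γ → Γ γ → tr (eval FOUR γ w) ≡ true) → tr (eval FOUR φ w) ≡ true) →
    ∀ v → (∀ γ → Γ γ → Designated (eval A γ v)) → Designated (eval A φ v)
  consequence em Γ φ e e-Γ e-φ Γ⊢φ v vΓ with em {Designated (eval A φ v)}
  ... | yes vφ  = vφ
  ... | no  ¬vφ = contradiction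
      (tr-represents (represents-term φ e-φ)
        (Γ⊢φ _ λ γ γ∈Γ → represents-tr isFilter excludes (represents-term γ (e-Γ γ γ∈Γ))
                           (IsFilter.designated isFilter (vΓ γ γ∈Γ))))
      excludes
    where
    open Separator (separate em (v ∘ e) ¬vφ)
    represents-term : ∀ t → Enumerates e t → Represents D (eval A t v) (eval FOUR t (truthValue em {D} ∘ v))
    represents-term t e-t = represents-eval isFilter t λ i∈t → represents-var (e-t i∈t)
      where
      represents-var : ∀ {i} → ∃ (λ n → e n ≡ i) → Represents D (v i) (truthValue em {D} (v i))
      represents-var (n , refl) = represents-truthValue em (decides n) (decides-¬ n)

  tautology-designated : ∀ {f} → ExcludedMiddle ℓ → {X : Set x} (φ : Term X) →
    (∀ (w : X → Four {f}) → tr (eval FOUR φ w) ≡ true) → ∀ v → Designated (eval A φ v)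
  tautology-designated em φ ⊢φ v = consequence em (λ _ → Lift ℓ Empty.⊥) φ (enumerate (leftmost φ) (vars φ))
    (λ _ ()) (enumerate-∈ (leftmost φ)) (λ w _ → ⊢φ w) v (λ _ ())

  -- An identity of FOUR yields four tautologies, which are exactly the premises of `⊃-antisym`.
  FOUR-complete : ∀ {f} → ExcludedMiddle ℓ → {X : Set x} (s t : Term X) →
                  _⊨_≋_ (FOUR {f}) s t → _⊨_≋_ A s t
  FOUR-complete em s t s≋t v = ⊃-antisym
    (tautology-designated em (s ⊃ᶠ t) (λ w → tr-⊃-refl (s≋t w)) v)
    (tautology-designated em (t ⊃ᶠ s) (λ w → tr-⊃-refl (sym (s≋t w))) v)
    (tautology-designated em ((¬ᶠ s) ⊃ᶠ (¬ᶠ t)) (λ w → tr-⊃-refl (cong Four-operations.¬_ (s≋t w))) v)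
    (tautology-designated em ((¬ᶠ t) ⊃ᶠ (¬ᶠ s)) (λ w → tr-⊃-refl (cong Four-operations.¬_ (sym (s≋t w)))) v)

-- A is the image of the free algebra over its own carrier, which consists of the
-- terms modulo the identities of FOUR and thus embeds in a power of FOUR.
ImpBiLat⊆V : ExcludedMiddle ℓ → ∀ {A} → ImpBiLat {ℓ} A → V ｛ FOUR {ℓ} ｝ A
ImpBiLat⊆V {ℓ} em {A} isIB =
  image (λ t → eval A t id) (record
    { isHomomorphism = record
      { ≈-homo = λ {s} {t} s≋t → FOUR-complete em s t s≋t id
      ; ∧-homo = λ _ _ → ≈.refl ; ∨-homo = λ _ _ → ≈.refl
      ; ⊗-homo = λ _ _ → ≈.refl ; ⊕-homo = λ _ _ → ≈.refl
      ; ⊃-homo = λ _ _ → ≈.refl ; ¬-homo = λ _ → ≈.refl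
      }
    ; surjective = λ p → var p , λ {t} t≋p → FOUR-complete em t (var p) t≋p id
    })
    (subalgebra {A = Free} (λ t w → eval FOUR t w) (record
      { isHomomorphism = record
        { ≈-homo = id
        ; ∧-homo = λ _ _ _ → refl ; ∨-homo = λ _ _ _ → refl
        ; ⊗-homo = λ _ _ _ → refl ; ⊕-homo = λ _ _ _ → refl
        ; ⊃-homo = λ _ _ _ → refl ; ¬-homo = λ _ _ → refl
        }
      ; injective = id
      })
      (product (Carrier → Four) (λ _ → FOUR) (λ _ → generator refl)))
  where
  open Algebra A using (Carrier)
  open ImplicativeBilattice isIB using (FOUR-complete)
  module ≈ = IsEquivalence (Algebra.≈-equivalence A)
  open Four-operations
  Free : Algebra ℓ
  Free = record
    { Carrier = Term Carrier
    ; _≈_ = _⊨_≋_ (FOUR {ℓ})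
    ; _∧_ = _∧ᶠ_ ; _∨_ = _∨ᶠ_ ; _⊗_ = _⊗ᶠ_ ; _⊕_ = _⊕ᶠ_ ; _⊃_ = _⊃ᶠ_ ; ¬_ = ¬ᶠ_
    ; ≈-equivalence = record
      { refl = λ _ → refl ; sym = λ e w → sym (e w) ; trans = λ e e′ w → trans (e w) (e′ w) }
    ; ∧-cong = λ e e′ w → cong₂ _∧_ (e w) (e′ w) ; ∨-cong = λ e e′ w → cong₂ _∨_ (e w) (e′ w)
    ; ⊗-cong = λ e e′ w → cong₂ _⊗_ (e w) (e′ w) ; ⊕-cong = λ e e′ w → cong₂ _⊕_ (e w) (e′ w)
    ; ⊃-cong = λ e e′ w → cong₂ _⊃_ (e w) (e′ w) ; ¬-cong = λ e w → cong ¬_ (e w)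
    }

-- Implicative bilattices from the identities of FOUR.

pattern x₀ = var zero
pattern x₁ = var (suc zero)
pattern x₂ = var (suc (suc zero))
pattern x₃ = var (suc (suc (suc zero)))

assign : X → X → X → X → ℕ → X
assign p q r s zero                = p
assign p q r s (suc zero)          = q
assign p q r s (suc (suc zero))    = r
assign p q r s (suc (suc (suc _))) = s

-- The two order conditions on `¬` are implications rather than identities; they are derived from De
-- Morgan identities. The level `f` is kept apart from `ℓ` because the variety uses the copy of FOUR
-- at `ℓ` and the logic the one at `0ℓ`.
identities⇒ImpBiLat : ∀ (f : Level) {A : Algebra ℓ} →
  (∀ (s t : Formula) → _⊨_≋_ (FOUR {f}) s t → _⊨_≋_ A s t) → ImpBiLat A
identities⇒ImpBiLat f {A} transfer = record
  { isBilattice = record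
    { isLatticeₜ = record
      { isEquivalence = ≈-equivalence
      ; ∨-comm     = λ p q → law (x₀ ∨ᶠ x₁) (x₁ ∨ᶠ x₀) (λ w → FT.∨-comm (w 0) (w 1)) p q q
      ; ∨-assoc    = law ((x₀ ∨ᶠ x₁) ∨ᶠ x₂) (x₀ ∨ᶠ (x₁ ∨ᶠ x₂)) (λ w → FT.∨-assoc (w 0) (w 1) (w 2))
      ; ∨-cong     = ∨-cong
      ; ∧-comm     = λ p q → law (x₀ ∧ᶠ x₁) (x₁ ∧ᶠ x₀) (λ w → FT.∧-comm (w 0) (w 1)) p q q
      ; ∧-assoc    = law ((x₀ ∧ᶠ x₁) ∧ᶠ x₂) (x₀ ∧ᶠ (x₁ ∧ᶠ x₂)) (λ w → FT.∧-assoc (w 0) (w 1) (w 2))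
      ; ∧-cong     = ∧-cong
      ; absorptive = ∨-absorbs-∧ , ∧-absorbs-∨
      }
    ; isLatticeₖ = record
      { isEquivalence = ≈-equivalence
      ; ∨-comm     = λ p q → law (x₀ ⊕ᶠ x₁) (x₁ ⊕ᶠ x₀) (λ w → FK.∨-comm (w 0) (w 1)) p q q
      ; ∨-assoc    = law ((x₀ ⊕ᶠ x₁) ⊕ᶠ x₂) (x₀ ⊕ᶠ (x₁ ⊕ᶠ x₂)) (λ w → FK.∨-assoc (w 0) (w 1) (w 2))
      ; ∨-cong     = ⊕-cong
      ; ∧-comm     = λ p q → law (x₀ ⊗ᶠ x₁) (x₁ ⊗ᶠ x₀) (λ w → FK.∧-comm (w 0) (w 1)) p q q
      ; ∧-assoc    = law ((x₀ ⊗ᶠ x₁) ⊗ᶠ x₂) (x₀ ⊗ᶠ (x₁ ⊗ᶠ x₂)) (λ w → FK.∧-assoc (w 0) (w 1) (w 2))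
      ; ∧-cong     = ⊗-cong
      ; absorptive = (λ p q → law (x₀ ⊕ᶠ (x₀ ⊗ᶠ x₁)) x₀ (λ w → FK.∨-absorbs-∧ (w 0) (w 1)) p q q)
                   , (λ p q → law (x₀ ⊗ᶠ (x₀ ⊕ᶠ x₁)) x₀ (λ w → FK.∧-absorbs-∨ (w 0) (w 1)) p q q)
      }
    ; ¬-antitoneₜ  = λ p q p≤q → begin
        ¬ q ∧ ¬ p          ≈⟨ ∧-cong ≈.refl (¬-cong p≤q) ⟨
        ¬ q ∧ ¬ (p ∧ q)    ≈⟨ ∧-cong ≈.refl (¬-∧ p q) ⟩
        ¬ q ∧ (¬ q ∨ ¬ p)  ≈⟨ ∧-absorbs-∨ (¬ q) (¬ p) ⟩
        ¬ q                ∎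
    ; ¬-monotoneₖ  = λ p q p≤q → ≈.trans (≈.sym (¬-⊗ p q)) (¬-cong p≤q)
    ; ¬-involutive = λ p → law (¬ᶠ (¬ᶠ x₀)) x₀ (λ w → FB.¬-involutive (w 0)) p p p
    }
  ; ib₁  = λ p q → law ((x₀ ⊃ᶠ x₀) ⊃ᶠ x₁) x₁ (λ w → F.ib₁ (w 0) (w 1)) p q q
  ; ib₂∧ = law (x₀ ⊃ᶠ (x₁ ⊃ᶠ x₂)) ((x₀ ∧ᶠ x₁) ⊃ᶠ x₂) (λ w → F.ib₂∧ (w 0) (w 1) (w 2))
  ; ib₂⊗ = law ((x₀ ∧ᶠ x₁) ⊃ᶠ x₂) ((x₀ ⊗ᶠ x₁) ⊃ᶠ x₂) (λ w → F.ib₂⊗ (w 0) (w 1) (w 2))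
  ; ib₃  = λ p q → law (((x₀ ⊃ᶠ x₁) ⊃ᶠ x₀) ⊃ᶠ x₀) (x₀ ⊃ᶠ x₀) (λ w → F.ib₃ (w 0) (w 1)) p q q
  ; ib₄∨ = law ((x₀ ∨ᶠ x₁) ⊃ᶠ x₂) ((x₀ ⊃ᶠ x₂) ∧ᶠ (x₁ ⊃ᶠ x₂)) (λ w → F.ib₄∨ (w 0) (w 1) (w 2))
  ; ib₄⊕ = law ((x₀ ⊃ᶠ x₂) ∧ᶠ (x₁ ⊃ᶠ x₂)) ((x₀ ⊕ᶠ x₁) ⊃ᶠ x₂) (λ w → F.ib₄⊕ (w 0) (w 1) (w 2))
  ; ib₅  = λ p q → law (x₀ ∧ᶠ ((x₀ ⊃ᶠ x₁) ⊃ᶠ (x₀ ⊗ᶠ x₁))) x₀ (λ w → F.ib₅ (w 0) (w 1)) p q q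
  ; ib₆  = law ((¬ᶠ (x₀ ⊃ᶠ x₁)) ⊃ᶠ x₂) ((x₀ ∧ᶠ (¬ᶠ x₁)) ⊃ᶠ x₂) (λ w → F.ib₆ (w 0) (w 1) (w 2))
  }
  where
  open Algebra A
  module ≈ = IsEquivalence ≈-equivalence
  open SetoidReasoning (setoid A)
  module F  = IsImplicativeBilattice (FOUR-isImplicativeBilattice {f})
  module FB = IsBilattice F.isBilattice
  module FT = IsLattice FB.isLatticeₜ
  module FK = IsLattice FB.isLatticeₖ
  module FN = Bilattice F.isBilattice

  law : ∀ s t → _⊨_≋_ (FOUR {f}) s t → ∀ p q r → eval A s (assign p q r r) ≈ eval A t (assign p q r r)
  law s t s≋t p q r = transfer s t s≋t (assign p q r r)

  ∨-absorbs-∧ : ∀ p q → p ∨ (p ∧ q) ≈ p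
  ∨-absorbs-∧ p q = law (x₀ ∨ᶠ (x₀ ∧ᶠ x₁)) x₀ (λ w → FT.∨-absorbs-∧ (w 0) (w 1)) p q q

  ∧-absorbs-∨ : ∀ p q → p ∧ (p ∨ q) ≈ p
  ∧-absorbs-∨ p q = law (x₀ ∧ᶠ (x₀ ∨ᶠ x₁)) x₀ (λ w → FT.∧-absorbs-∨ (w 0) (w 1)) p q q

  ¬-∧ : ∀ p q → ¬ (p ∧ q) ≈ ¬ q ∨ ¬ p
  ¬-∧ p q = law (¬ᶠ (x₀ ∧ᶠ x₁)) ((¬ᶠ x₁) ∨ᶠ (¬ᶠ x₀))
    (λ w → trans (FN.¬-∧ (w 0) (w 1)) (FT.∨-comm (Four-operations.¬_ (w 0)) (Four-operations.¬_ (w 1)))) p q q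

  ¬-⊗ : ∀ p q → ¬ (p ⊗ q) ≈ ¬ p ⊗ ¬ q
  ¬-⊗ p q = law (¬ᶠ (x₀ ⊗ᶠ x₁)) ((¬ᶠ x₀) ⊗ᶠ (¬ᶠ x₁)) (λ w → FN.¬-⊗ (w 0) (w 1)) p q q

V⊆ImpBiLat : ∀ {A} → V ｛ FOUR {ℓ} ｝ A → ImpBiLat A
V⊆ImpBiLat {ℓ} A∈V = identities⇒ImpBiLat ℓ λ s t s≋t → V-⊨ s t (λ { refl → s≋t }) A∈V

-- Reduced models of the logic.

ImpBiLat⊆Alg* : ExcludedMiddle ℓ → ∀ {A} → ImpBiLat {ℓ} A → Alg*LB⊃ A
ImpBiLat⊆Alg* em {A} isIB = Designated , designated-resp , isModel , isReduced
  where
  open Algebra A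
  open ImplicativeBilattice isIB
  module ≈ = IsEquivalence ≈-equivalence

  isModel : IsModel A Designated
  isModel Γ φ Γ⊢φ h h-homo hΓ = designated-resp (≈.sym (h-eval φ))
    -- Variables of formulas are natural numbers, so `id` enumerates those of all premises at once.
    (consequence em Γ φ id (λ _ _ {n} _ → n , refl) (λ {n} _ → n , refl)
      (λ w wΓ → Tr⇒tr (Γ⊢φ (λ t → eval FOUR t w) (eval-isHomomorphism FOUR w) (λ γ γ∈Γ → tr⇒Tr (wΓ γ γ∈Γ))))
      (h ∘ var) (λ γ γ∈Γ → designated-resp (h-eval γ) (hΓ γ γ∈Γ)))
    where
    h-eval = homomorphism-eval A h-homo

  isReduced : IsReduced A Designated
  isReduced = record
    { isCompatibleCongruence = record
      { reflexive = id ; isEquivalence = ≈-equivalence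
      ; ∧-compatible = ∧-cong ; ∨-compatible = ∨-cong
      ; ⊗-compatible = ⊗-cong ; ⊕-compatible = ⊕-cong
      ; ⊃-compatible = ⊃-cong ; ¬-compatible = ¬-cong
      ; F-compatible = designated-resp
      }
    ; greatest = λ ρ ρ-compatible pρq →
        let open IsCompatibleCongruence ρ-compatible
            module ρ = IsEquivalence isEquivalence
            -- A congruence relating `p` and `q` relates the designated `p ⊃ p` to `p ⊃ q`, and
            -- compatibility transports designation.
            implies : ∀ {p q} → ρ p q → Designated (p ⊃ q)
            implies pρq = F-compatible (⊃-compatible ρ.refl pρq) (designated-refl _)
        in ⊃-antisym (implies pρq) (implies (ρ.sym pρq))
             (implies (¬-compatible pρq)) (implies (¬-compatible (ρ.sym pρq)))
    }

-- The equivalence formulas of the algebraizable logic. The negated pair is essential: `⊤` and `𝗍`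
-- imply each other.
_⇔_ : Formula → Formula → List Formula
s ⇔ t = s ⊃ᶠ t ∷ t ⊃ᶠ s ∷ (¬ᶠ s) ⊃ᶠ (¬ᶠ t) ∷ (¬ᶠ t) ⊃ᶠ (¬ᶠ s) ∷ []

Valid : (ℕ → Four) → Pred Formula 0ℓ
Valid w φ = Tr (eval FOUR φ w)

-- FOUR is itself an implicative bilattice in which the elements of `Tr` are designated, so
-- `⊃-antisym` applies to it.
⇔-sound : ∀ {w} s t → All (Valid w) (s ⇔ t) → eval FOUR s w ≡ eval FOUR t w
⇔-sound s t (d₁ ∷ d₂ ∷ d₃ ∷ d₄ ∷ []) =
  ⊃-antisym (Tr⇒designated d₁) (Tr⇒designated d₂) (Tr⇒designated d₃) (Tr⇒designated d₄)
  where
  open ImplicativeBilattice FOUR-isImplicativeBilattice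
  Tr⇒designated : ∀ {v} → Tr v → Designated v
  Tr⇒designated ⊤∈Tr = refl
  Tr⇒designated 𝗍∈Tr = refl

module ReducedModel {A : Algebra ℓ} {F : Pred (Algebra.Carrier A) ℓ} (F-resp : F Respects Algebra._≈_ A)
                    (isModel : IsModel A F) (isReduced : IsReduced A F) where
  open Algebra A

  -- A homomorphism from `Fm` is evaluation at its values on the variables, so the model condition
  -- can be used with valuations.
  closed : ∀ Γ φ → (∀ w → All (Valid w) Γ → Valid w φ) →
           ∀ v → All (λ γ → F (eval A γ v)) Γ → F (eval A φ v)
  closed Γ φ Γ⊢φ v vΓ = isModel (λ γ → Lift ℓ (γ ∈ Γ)) φ
    (λ h h-homo hΓ → let h-eval = homomorphism-eval FOUR h-homo in
      subst Tr (sym (h-eval φ)) (Γ⊢φ (h ∘ var) (All.tabulate λ γ∈Γ → subst Tr (h-eval _) (hΓ _ (lift γ∈Γ)))))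
    (λ t → eval A t v) (eval-isHomomorphism A v)
    (λ γ γ∈Γ → All.lookup vΓ (lower γ∈Γ))

  infix 4 _∼_
  _∼_ : Rel Carrier ℓ
  p ∼ q = F (p ⊃ q) × F (q ⊃ p) × F (¬ p ⊃ ¬ q) × F (¬ q ⊃ ¬ p)

  -- Replacing every equation by its `⇔` formulas turns a quasi-identity of FOUR into finitary
  -- consequences of the logic, under which `F` is closed. The congruence laws of `∼` are instances.
  quasi-identity : ∀ (E : List (Formula × Formula)) s t →
    (∀ w → All (λ (l , r) → eval FOUR l w ≡ eval FOUR r w) E → eval FOUR s w ≡ eval FOUR t w) →
    ∀ v → All (λ (l , r) → eval A l v ∼ eval A r v) E → eval A s v ∼ eval A t v
  quasi-identity E s t E⊨s≋t v vE =
    derive s t E⊨s≋t , derive t s (λ w → sym ∘ E⊨s≋t w) ,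
    derive (¬ᶠ s) (¬ᶠ t) (λ w → cong ¬₄_ ∘ E⊨s≋t w) ,
    derive (¬ᶠ t) (¬ᶠ s) (λ w → cong ¬₄_ ∘ sym ∘ E⊨s≋t w)
    where
    open Four-operations using () renaming (¬_ to ¬₄_)
    derive : ∀ s t → (∀ w → All (λ (l , r) → eval FOUR l w ≡ eval FOUR r w) E → eval FOUR s w ≡ eval FOUR t w) →
             F (eval A s v ⊃ eval A t v)
    derive s t E⊨s≋t = closed (concatMap (uncurry _⇔_) E) (s ⊃ᶠ t)
      (λ w wE → tr⇒Tr (tr-⊃-refl (E⊨s≋t w (All.map (⇔-sound _ _) (map⁻ (concat⁻ wE))))))
      v (concat⁺ (map⁺ (All.map (λ (d₁ , d₂ , d₃ , d₄) → d₁ ∷ d₂ ∷ d₃ ∷ d₄ ∷ []) vE)))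

  ∼-isCompatibleCongruence : IsCompatibleCongruence A F _∼_
  ∼-isCompatibleCongruence = record
    { reflexive     = reflexive
    ; isEquivalence = record
      { refl  = ∼-refl
      ; sym   = λ (d₁ , d₂ , d₃ , d₄) → d₂ , d₁ , d₄ , d₃
      ; trans = λ {p} {q} {r} p∼q q∼r → quasi-identity ((x₀ , x₁) ∷ (x₁ , x₂) ∷ []) x₀ x₂
                  (λ { w (e₁ ∷ e₂ ∷ []) → trans e₁ e₂ }) (assign p q r r) (p∼q ∷ q∼r ∷ [])
      }
    ; ∧-compatible  = compatible₂ _∧ᶠ_ (λ _ → cong₂ Four-operations._∧_)
    ; ∨-compatible  = compatible₂ _∨ᶠ_ (λ _ → cong₂ Four-operations._∨_)
    ; ⊗-compatible  = compatible₂ _⊗ᶠ_ (λ _ → cong₂ Four-operations._⊗_)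
    ; ⊕-compatible  = compatible₂ _⊕ᶠ_ (λ _ → cong₂ Four-operations._⊕_)
    ; ⊃-compatible  = compatible₂ _⊃ᶠ_ (λ _ → cong₂ Four-operations._⊃_)
    ; ¬-compatible  = λ {p} {q} p∼q → quasi-identity [ x₀ , x₁ ] (¬ᶠ x₀) (¬ᶠ x₁)
                        (λ { w (e ∷ []) → cong Four-operations.¬_ e }) (assign p q q q) (p∼q ∷ [])
    ; F-compatible  = λ {p} {q} (p⊃q , _) Fp → closed (x₀ ∷ x₀ ⊃ᶠ x₁ ∷ []) x₁
                        (λ { w (w₀ ∷ w₁ ∷ []) → modus-ponens w₀ w₁ }) (assign p q q q) (Fp ∷ p⊃q ∷ [])
    }
    where
    ∼-refl : ∀ {p} → p ∼ p
    ∼-refl {p} = quasi-identity [] x₀ x₀ (λ _ _ → refl) (assign p p p p) []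

    reflexive : ∀ {p q} → p ≈ q → p ∼ q
    reflexive p≈q = let d₁ , d₂ , d₃ , d₄ = ∼-refl in
      F-resp (⊃-cong ≈.refl p≈q) d₁ , F-resp (⊃-cong p≈q ≈.refl) d₂ ,
      F-resp (⊃-cong ≈.refl (¬-cong p≈q)) d₃ , F-resp (⊃-cong (¬-cong p≈q) ≈.refl) d₄
      where module ≈ = IsEquivalence ≈-equivalence

    -- Stated for a formula constructor so that, at each concrete one, `eval` computes the
    -- conclusion to compatibility of the corresponding operation.
    compatible₂ : ∀ (_∙_ : Formula → Formula → Formula) →
      (∀ (w : ℕ → Four) → w 0 ≡ w 1 → w 2 ≡ w 3 → eval FOUR (x₀ ∙ x₂) w ≡ eval FOUR (x₁ ∙ x₃) w) →
      ∀ {p q r s} → p ∼ q → r ∼ s → eval A (x₀ ∙ x₂) (assign p q r s) ∼ eval A (x₁ ∙ x₃) (assign p q r s)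
    compatible₂ _∙_ ∙-cong {p} {q} {r} {s} p∼q r∼s =
      quasi-identity ((x₀ , x₁) ∷ (x₂ , x₃) ∷ []) (x₀ ∙ x₂) (x₁ ∙ x₃)
        (λ { w (e₁ ∷ e₂ ∷ []) → ∙-cong w e₁ e₂ }) (assign p q r s) (p∼q ∷ r∼s ∷ [])

    modus-ponens : ∀ {v w} → Tr v → Tr (v Four-operations.⊃ w) → Tr w
    modus-ponens ⊤∈Tr = id
    modus-ponens 𝗍∈Tr = id

  isImplicativeBilattice : ImpBiLat A
  isImplicativeBilattice = identities⇒ImpBiLat 0ℓ λ s t s≋t v →
    -- Reducedness puts `∼` inside `≈`, and an identity is a quasi-identity without premises.
    IsGreatestCompatibleCongruence.greatest isReduced _∼_ ∼-isCompatibleCongruence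
      (quasi-identity [] s t (λ w _ → s≋t w) v [])

Alg*⊆ImpBiLat : ∀ {A : Algebra ℓ} → Alg*LB⊃ A → ImpBiLat A
Alg*⊆ImpBiLat (F , F-resp , isModel , isReduced) =
  ReducedModel.isImplicativeBilattice F-resp isModel isReduced

theorem5p2p1 : ∀ (ℓ : Level) → ExcludedMiddle ℓ →
    (ImpBiLat {ℓ} ≐ V ｛ FOUR {ℓ} ｝) × (Alg*LB⊃ {ℓ} ≐ V ｛ FOUR {ℓ} ｝)
theorem5p2p1 ℓ em =
  (ImpBiLat⊆V em , V⊆ImpBiLat) ,
  (ImpBiLat⊆V em ∘ Alg*⊆ImpBiLat , ImpBiLat⊆Alg* em ∘ V⊆ImpBiLat)
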